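{- Let $R=(R,\oplus,\odot,0_R,1_R)$ be a ring and let $t$ and $u$ be ring terms over $R$. Then $t$ and $u$ are s-equivalent if and only if they are f-equivalent: $$t\stackrel{s}{\approx}u\iff t\stackrel{f}{\approx}u.$$
   Context: Rings are commutative with identity, and $0_R\neq 1_R$. $\mathbb{N}=\{1,2,\dots\}$, $\mathbb{N}_0=\{0,1,2,\dots\}$. Ring terms. Let $V=\{x_1,x_2,\dots\}$ be a countable set of distinct variables and let $F_R=\{+,\cdot,0,1\}\cup\{c_r: r\in R\}$ be a set of distinct formal symbols ($0,1,c_r$ are constants; $0$ and $c_{0_R}$ are different symbols, and so are $1$ and $c_{1_R}$). (Ring) terms over $R$ are the words over $V\cup F_R\cup\{(\,,\,)\}$ obtained by finitely many applications of the rules: each constant $0$, $1$, $c_r$ ($r\in R$) and each variable is a term; if $t,u$ are terms then $(t+u)$ and $(t\cdot u)$ are terms. $T$ is the set of all terms. A subterm of $t$ is a term occurring as a contiguous subword of $t$; replacing a subterm means replacing one occurrence of it. Standard polynomials. $\mathbb{N}_0^{\infty}$ is the set of finite sequences over $\mathbb{N}_0$ that are empty or have nonzero last entry; the sum of two such sequences is computed entrywise after padding the shorter one with zeros. $R[x_1,x_2,\dots]$ is the set of all maps $p\colon X\to R\setminus\{0_R\}$ (viewed as sets of pairs) with finite $X\subset\mathbb{N}_0^{\infty}$. Extending $p,q$ by $0_R$ outside their domains, $p\oplus_s q$ and $p\odot_s q$ are the restrictions to the sets of nonzero values of, respectively, $\overline{m}\mapsto p(\overline{m})\oplus q(\overline{m})$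 and $\overline{m}\mapsto\bigoplus_{\overline{k}+\overline{l}=\overline{m}}p(\overline{k})\odot q(\overline{l})$. The map $\Psi\colon T\to R[x_1,x_2,\dots]$ evaluates terms: $\Psi[0]=\Psi[c_{0_R}]=\emptyset$, $\Psi[1]=\{(\emptyset,1_R)\}$, $\Psi[c_r]=\{(\emptyset,r)\}$ for $r\ne0_R$, $\Psi[x_i]=\{((0,\dots,0,1),1_R)\}$ (with an $i$-tuple), $\Psi[(t+u)]=\Psi[t]\oplus_s\Psi[u]$, $\Psi[(t\cdot u)]=\Psi[t]\odot_s\Psi[u]$. s-equivalence: $t\stackrel{s}{\approx}u$ iff $\Psi[t]=\Psi[u]$. f-equivalence: write $t\sim t'$ (and $t'\sim t$; the relation is symmetric) if $t'$ arises from $t$ by replacing a subterm $v$ with $v'$ according to one of the following rules, for some $r,s\in R$ and terms $u,u',u''$. ET$-1$: $v=0$, $v'=c_{0_R}$. ET0: $v=1$, $v'=c_{1_R}$. ET1: $v=(c_r+c_s)$, $v'=c_{r\oplus s}$. ET2: $v=(c_r\cdot c_s)$, $v'=c_{r\odot s}$. ET3: $v=(0+u)$, $v'=u$. ET4: $v=(1\cdot u)$, $v'=u$. ET5: $v=(u+u')$, $v'=(u'+u)$. ET6: $v=(u\cdot u')$, $v'=(u'\cdot u)$. ET7: $v=(u+(u'+u''))$, $v'=((u+u')+u'')$. ET8: $v=(u\cdot(u'\cdot u''))$, $v'=((u\cdot u')\cdot u'')$. ET9: $v=(u\cdot(u'+u''))$, $v'=((u\cdot u')+(u\cdot u''))$.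 ET10: $v=(0\cdot u)$, $v'=0$. Then $t\stackrel{f}{\approx}u$ iff there are $k\in\mathbb{N}$ and terms $t_0,\dots,t_k$ with $t=t_0\sim t_1\sim\dots\sim t_k=u$. -}

module Defs where

open import Algebra.Bundles using (CommutativeRing)
open import Data.Bool.Base using (if_then_else_)
open import Data.List.Base
  using (List; []; _∷_; _++_; last; map; foldr; replicate; upTo; cartesianProductWith)
import Data.List.Properties as List
open import Data.Empty using (⊥; ⊥-elim-irr)
open import Data.List.Membership.Propositional using (_∈_; _∉_)
open import Data.List.Membership.Propositional.Properties
  using (∈-++⁺ˡ; ∈-++⁺ʳ; ∈-cartesianProductWith⁺; ∈-cartesianProductWith⁻; ∈-upTo⁺; ∈-upTo⁻)
open import Data.List.Relation.Unary.All using ([])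
open import Data.List.Relation.Unary.Any using (here; there)
open import Data.List.Relation.Unary.Unique.Propositional using (Unique; []; _∷_)
import Data.List.Relation.Unary.Unique.Propositional.Properties as Unique
open import Data.Maybe.Relation.Unary.All using (All; just; nothing)
open import Data.Nat.Base using (ℕ; zero; suc; _∸_; NonZero; s≤s; s≤s⁻¹)
import Data.Nat.Base as ℕ
import Data.Nat.Properties as ℕ
open import Data.Product.Base using (_×_; _,_; ∃₂; proj₁; proj₂)
open import Level using (_⊔_)
open import Relation.Binary.Construct.Closure.Symmetric using (SymClosure)
open import Relation.Binary.Construct.Closure.Transitive using (TransClosure)
open import Relation.Binary.Definitions using (DecidableEquality)
open import Relation.Binary.PropositionalEquality
  using (_≡_; refl; sym; trans; cong; cong₂; subst)
open import Relation.Nullary using (¬_; does; yes; no; contradiction)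
open import Relation.Nullary.Decidable using (map′; dec-false)
import Data.List.Membership.DecPropositional as DecMembership

------------------------------------------------------------------------
-- Exponents

-- Finite sequences over ℕ that are empty or have nonzero last entry.
record ℕ₀^∞ : Set where
  constructor mk
  field
    seq        : List ℕ
    .canonical : All NonZero (last seq)

open ℕ₀^∞ public

seq-injective : ∀ {k l} → seq k ≡ seq l → k ≡ l
seq-injective refl = refl

infix 4 _≟_
_≟_ : DecidableEquality ℕ₀^∞
k ≟ l = map′ seq-injective (cong seq) (List.≡-dec ℕ._≟_ (seq k) (seq l))

ε : ℕ₀^∞
ε = mk [] nothing

-- The sequence (0,…,0,1) of length i + 1.
unit : ℕ → ℕ₀^∞
unit i = mk (replicate i 0 ++ 1 ∷ []) (nz i)
  where
  nz : ∀ i → All NonZero (last (replicate i 0 ++ 1 ∷ []))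
  nz zero          = just _
  nz (suc zero)    = just _
  nz (suc (suc i)) = nz (suc i)

padAdd : List ℕ → List ℕ → List ℕ
padAdd []      l       = l
padAdd (a ∷ k) []      = a ∷ k
padAdd (a ∷ k) (b ∷ l) = a ℕ.+ b ∷ padAdd k l

padAdd-canonical : ∀ k l → All NonZero (last k) → All NonZero (last l) →
                   All NonZero (last (padAdd k l))
padAdd-canonical []           l            _         q = q
padAdd-canonical (a ∷ k)      []           p         _ = p
padAdd-canonical (suc a ∷ []) (b ∷ [])     _         _ = just _
padAdd-canonical (zero ∷ [])  (b ∷ [])     _         q = q
padAdd-canonical (a ∷ [])     (b ∷ b′ ∷ l) _         q = q
padAdd-canonical (a ∷ a′ ∷ k) (b ∷ [])     p         _ = p
padAdd-canonical (a ∷ a′ ∷ k) (b ∷ b′ ∷ l) p         q =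
  padAdd-canonical (a′ ∷ k) (b′ ∷ l) p q

infixl 6 _+ₑ_
_+ₑ_ : ℕ₀^∞ → ℕ₀^∞ → ℕ₀^∞
mk k p +ₑ mk l q = mk (padAdd k l) (padAdd-canonical k l p q)

-- Puts an entry in front; the one-term sequence (0) is normalised to ε.
cons : ℕ → ℕ₀^∞ → ℕ₀^∞
cons zero    (mk [] _)      = ε
cons zero    (mk (b ∷ l) p) = mk (zero ∷ b ∷ l) p
cons (suc a) (mk [] _)      = mk (suc a ∷ []) (just _)
cons (suc a) (mk (b ∷ l) p) = mk (suc a ∷ b ∷ l) p

-- `splits m` lists every pair (k , l) with k +ₑ l ≡ m exactly once: see
-- `splits-sound`, `splits-complete` and `splits-unique`.
splitsSeq : List ℕ → List (ℕ₀^∞ × ℕ₀^∞)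
splitsSeq []      = (ε , ε) ∷ []
splitsSeq (a ∷ m) =
  cartesianProductWith (λ { i (k , l) → cons i k , cons (a ∸ i) l })
                       (upTo (suc a)) (splitsSeq m)

splits : ℕ₀^∞ → List (ℕ₀^∞ × ℕ₀^∞)
splits m = splitsSeq (seq m)

hd : ℕ₀^∞ → ℕ
hd (mk [] _)      = 0
hd (mk (a ∷ _) _) = a

tl : ℕ₀^∞ → ℕ₀^∞
tl (mk [] _)          = ε
tl (mk (a ∷ []) _)    = ε
tl (mk (_ ∷ b ∷ l) p) = mk (b ∷ l) p

hd-cons : ∀ a k → hd (cons a k) ≡ a
hd-cons zero    (mk [] _)      = refl
hd-cons zero    (mk (_ ∷ _) _) = refl
hd-cons (suc a) (mk [] _)      = refl
hd-cons (suc a) (mk (_ ∷ _) _) = refl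

tl-cons : ∀ a k → tl (cons a k) ≡ k
tl-cons zero    (mk [] _)      = refl
tl-cons zero    (mk (_ ∷ _) _) = refl
tl-cons (suc a) (mk [] _)      = refl
tl-cons (suc a) (mk (_ ∷ _) _) = refl

¬canonical-0 : ¬ All NonZero (last (0 ∷ []))
¬canonical-0 (just ())

cons-hd-tl : ∀ k → cons (hd k) (tl k) ≡ k
cons-hd-tl (mk [] _)               = refl
cons-hd-tl (mk (zero ∷ []) p)      = ⊥-elim-irr (¬canonical-0 p)
cons-hd-tl (mk (suc a ∷ []) _)     = refl
cons-hd-tl (mk (zero ∷ b ∷ l) _)   = refl
cons-hd-tl (mk (suc a ∷ b ∷ l) _)  = refl

cons-+ₑ : ∀ a b k l → cons a k +ₑ cons b l ≡ cons (a ℕ.+ b) (k +ₑ l)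
cons-+ₑ zero    zero    (mk [] _)      (mk [] _)      = refl
cons-+ₑ zero    zero    (mk [] _)      (mk (_ ∷ _) _) = refl
cons-+ₑ zero    zero    (mk (_ ∷ _) _) (mk [] _)      = refl
cons-+ₑ zero    zero    (mk (_ ∷ _) _) (mk (_ ∷ _) _) = refl
cons-+ₑ zero    (suc b) (mk [] _)      (mk [] _)      = refl
cons-+ₑ zero    (suc b) (mk [] _)      (mk (_ ∷ _) _) = refl
cons-+ₑ zero    (suc b) (mk (_ ∷ _) _) (mk [] _)      = refl
cons-+ₑ zero    (suc b) (mk (_ ∷ _) _) (mk (_ ∷ _) _) = refl
cons-+ₑ (suc a) zero    (mk [] _)      (mk [] _)      =
  seq-injective (cong (λ n → suc n ∷ []) (sym (ℕ.+-identityʳ a)))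
cons-+ₑ (suc a) zero    (mk [] _)      (mk (_ ∷ _) _) = refl
cons-+ₑ (suc a) zero    (mk (b ∷ k) _) (mk [] _)      =
  seq-injective (cong (λ n → suc n ∷ b ∷ k) (sym (ℕ.+-identityʳ a)))
cons-+ₑ (suc a) zero    (mk (_ ∷ _) _) (mk (_ ∷ _) _) = refl
cons-+ₑ (suc a) (suc b) (mk [] _)      (mk [] _)      = refl
cons-+ₑ (suc a) (suc b) (mk [] _)      (mk (_ ∷ _) _) = refl
cons-+ₑ (suc a) (suc b) (mk (b′ ∷ k) _) (mk [] _)     = refl
cons-+ₑ (suc a) (suc b) (mk (_ ∷ _) _) (mk (_ ∷ _) _) = refl

+ₑ-cons : ∀ k l → k +ₑ l ≡ cons (hd k ℕ.+ hd l) (tl k +ₑ tl l)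
+ₑ-cons k l =
  trans (sym (cong₂ _+ₑ_ (cons-hd-tl k) (cons-hd-tl l)))
        (cons-+ₑ (hd k) (hd l) (tl k) (tl l))

normalise : List ℕ → ℕ₀^∞
normalise []      = ε
normalise (a ∷ m) = cons a (normalise m)

normalise-seq : ∀ m .(p : All NonZero (last m)) → normalise m ≡ mk m p
normalise-seq []              _ = refl
normalise-seq (zero ∷ [])     p = ⊥-elim-irr (¬canonical-0 p)
normalise-seq (suc a ∷ [])    _ = refl
normalise-seq (zero ∷ b ∷ m)  p rewrite normalise-seq (b ∷ m) p = refl
normalise-seq (suc a ∷ b ∷ m) p rewrite normalise-seq (b ∷ m) p = refl

splitsSeq-sound : ∀ m {k l} → (k , l) ∈ splitsSeq m → k +ₑ l ≡ normalise m
splitsSeq-sound []      (here refl) = refl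
splitsSeq-sound (a ∷ m) kl∈
  with i , (k , l) , i∈ , kl∈′ , refl ←
         ∈-cartesianProductWith⁻ _ (upTo (suc a)) (splitsSeq m) kl∈ =
  trans (cons-+ₑ i (a ∸ i) k l)
        (cong₂ cons (ℕ.m+[n∸m]≡n (s≤s⁻¹ (∈-upTo⁻ i∈))) (splitsSeq-sound m kl∈′))

+ₑ≡ε : ∀ k l → k +ₑ l ≡ ε → (k , l) ≡ (ε , ε)
+ₑ≡ε (mk [] _)      (mk [] _)      _  = refl
+ₑ≡ε (mk [] _)      (mk (_ ∷ _) _) eq = contradiction (cong seq eq) λ ()
+ₑ≡ε (mk (_ ∷ _) _) (mk [] _)      eq = contradiction (cong seq eq) λ ()
+ₑ≡ε (mk (_ ∷ _) _) (mk (_ ∷ _) _) eq = contradiction (cong seq eq) λ ()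

splitsSeq-complete : ∀ m k l → k +ₑ l ≡ normalise m → (k , l) ∈ splitsSeq m
splitsSeq-complete []      k l eq = here (+ₑ≡ε k l eq)
splitsSeq-complete (a ∷ m) k l eq =
  subst (_∈ splitsSeq (a ∷ m))
    (cong₂ _,_ (cons-hd-tl k)
      (trans (cong (λ n → cons n (tl l)) a∸hd) (cons-hd-tl l)))
    (∈-cartesianProductWith⁺ _ (∈-upTo⁺ (s≤s hd≤))
      (splitsSeq-complete m (tl k) (tl l) tls))
  where
  eq′ : cons (hd k ℕ.+ hd l) (tl k +ₑ tl l) ≡ cons a (normalise m)
  eq′ = trans (sym (+ₑ-cons k l)) eq

  hds : hd k ℕ.+ hd l ≡ a
  hds = trans (sym (hd-cons _ _)) (trans (cong hd eq′) (hd-cons a _))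

  tls : tl k +ₑ tl l ≡ normalise m
  tls = trans (sym (tl-cons (hd k ℕ.+ hd l) _)) (trans (cong tl eq′) (tl-cons a _))

  hd≤ : hd k ℕ.≤ a
  hd≤ = subst (hd k ℕ.≤_) hds (ℕ.m≤m+n _ _)

  a∸hd : a ∸ hd k ≡ hd l
  a∸hd = trans (cong (_∸ hd k) (sym hds)) (ℕ.m+n∸m≡n (hd k) (hd l))

splitsSeq-unique : ∀ m → Unique (splitsSeq m)
splitsSeq-unique []      = [] ∷ []
splitsSeq-unique (a ∷ m) =
  Unique.cartesianProductWith⁺ _ inj (Unique.upTo⁺ (suc a)) (splitsSeq-unique m)
  where
  tails : ∀ i j k l → cons i k ≡ cons j l → k ≡ l
  tails i j k l eq = trans (sym (tl-cons i k)) (trans (cong tl eq) (tl-cons j l))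

  inj : ∀ {i j} {kl kl′ : ℕ₀^∞ × ℕ₀^∞} →
        (cons i (proj₁ kl) , cons (a ∸ i) (proj₂ kl)) ≡
        (cons j (proj₁ kl′) , cons (a ∸ j) (proj₂ kl′)) →
        i ≡ j × kl ≡ kl′
  inj {i} {j} {k , l} {k′ , l′} eq =
    trans (sym (hd-cons i k)) (trans (cong (λ x → hd (proj₁ x)) eq) (hd-cons j k′)) ,
    cong₂ _,_ (tails i j k k′ (cong proj₁ eq))
              (tails (a ∸ i) (a ∸ j) l l′ (cong proj₂ eq))

normalise-self : ∀ m → normalise (seq m) ≡ m
normalise-self (mk m p) = normalise-seq m p

splits-sound : ∀ m {k l} → (k , l) ∈ splits m → k +ₑ l ≡ m
splits-sound m kl∈ = trans (splitsSeq-sound (seq m) kl∈) (normalise-self m)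

splits-complete : ∀ k l → (k , l) ∈ splits (k +ₑ l)
splits-complete k l =
  splitsSeq-complete (seq (k +ₑ l)) k l (sym (normalise-self (k +ₑ l)))

splits-unique : ∀ m → Unique (splits m)
splits-unique m = splitsSeq-unique (seq m)

------------------------------------------------------------------------
-- Terms and polynomials over a fixed ring

module RingTerms {c ℓ} (R : CommutativeRing c ℓ) where

  private module R = CommutativeRing R
  open R using (Carrier; _≈_; 0#; 1#)

  ----------------------------------------------------------------------
  -- Terms

  infixl 6 _⊞_
  infixl 7 _⊠_

  -- Words are fully parenthesised, hence uniquely readable, so they are
  -- represented by their syntax trees.  Variables are numbered from 0:
  -- `var i` is x_{i+1}.
  data Term : Set c where
    𝟎 𝟏     : Term
    con     : Carrier → Term
    var     : ℕ → Term
    _⊞_ _⊠_ : Term → Term → Term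

  -- Identity of words.  Since equality in R is _≈_, the symbols c_r and
  -- c_s are the same exactly when r ≈ s.
  infix 4 _≐_
  data _≐_ : Term → Term → Set (c ⊔ ℓ) where
    𝟎   : 𝟎 ≐ 𝟎
    𝟏   : 𝟏 ≐ 𝟏
    con : ∀ {r s} → r ≈ s → con r ≐ con s
    var : ∀ i → var i ≐ var i
    _⊞_ : ∀ {t t′ u u′} → t ≐ t′ → u ≐ u′ → t ⊞ u ≐ t′ ⊞ u′
    _⊠_ : ∀ {t t′ u u′} → t ≐ t′ → u ≐ u′ → t ⊠ u ≐ t′ ⊠ u′

  ----------------------------------------------------------------------
  -- f-equivalence

  infix 4 _⟶_ _⇝_ _~_ _≈ᶠ_

  data _⟶_ : Term → Term → Set c where
    ET-1 : 𝟎 ⟶ con 0#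
    ET0  : 𝟏 ⟶ con 1#
    ET1  : ∀ r s → con r ⊞ con s ⟶ con (r R.+ s)
    ET2  : ∀ r s → con r ⊠ con s ⟶ con (r R.* s)
    ET3  : ∀ u → 𝟎 ⊞ u ⟶ u
    ET4  : ∀ u → 𝟏 ⊠ u ⟶ u
    ET5  : ∀ u u′ → u ⊞ u′ ⟶ u′ ⊞ u
    ET6  : ∀ u u′ → u ⊠ u′ ⟶ u′ ⊠ u
    ET7  : ∀ u u′ u″ → u ⊞ (u′ ⊞ u″) ⟶ (u ⊞ u′) ⊞ u″
    ET8  : ∀ u u′ u″ → u ⊠ (u′ ⊠ u″) ⟶ (u ⊠ u′) ⊠ u″
    ET9  : ∀ u u′ u″ → u ⊠ (u′ ⊞ u″) ⟶ (u ⊠ u′) ⊞ (u ⊠ u″)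
    ET10 : ∀ u → 𝟎 ⊠ u ⟶ 𝟎

  -- Replacement of one occurrence of a subterm.
  data _⇝_ : Term → Term → Set c where
    root : ∀ {v v′} → v ⟶ v′ → v ⇝ v′
    ⊞ˡ   : ∀ {t t′} u → t ⇝ t′ → t ⊞ u ⇝ t′ ⊞ u
    ⊞ʳ   : ∀ {u u′} t → u ⇝ u′ → t ⊞ u ⇝ t ⊞ u′
    ⊠ˡ   : ∀ {t t′} u → t ⇝ t′ → t ⊠ u ⇝ t′ ⊠ u
    ⊠ʳ   : ∀ {u u′} t → u ⇝ u′ → t ⊠ u ⇝ t ⊠ u′

  -- One replacement in either direction, between words taken up to _≐_.
  _~_ : Term → Term → Set (c ⊔ ℓ)
  t ~ t′ = ∃₂ λ v v′ → t ≐ v × SymClosure _⇝_ v v′ × v′ ≐ t′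

  _≈ᶠ_ : Term → Term → Set (c ⊔ ℓ)
  _≈ᶠ_ = TransClosure _~_

  ----------------------------------------------------------------------
  -- Standard polynomials

  -- A finite partial map p : X → R∖{0} is represented by its extension by
  -- 0# to all exponents, together with a finite list containing X.  The
  -- list is only a bound (X itself need not be decidable, because _≈_ is
  -- not assumed to be) and is ignored by equality of polynomials.
  record Poly : Set (c ⊔ ℓ) where
    field
      coeff   : ℕ₀^∞ → Carrier
      support : List ℕ₀^∞
      finite  : ∀ {m} → m ∉ support → coeff m ≈ 0#

  open Poly public

  infix 4 _≈ₚ_
  _≈ₚ_ : Poly → Poly → Set ℓ
  p ≈ₚ q = ∀ m → coeff p m ≈ coeff q m

  0ₚ : Poly
  0ₚ = record { coeff = λ _ → 0# ; support = [] ; finite = λ _ → R.refl }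

  -- {(k , r)}, or the empty map when r ≈ 0#.
  single : ℕ₀^∞ → Carrier → Poly
  single k r = record
    { coeff = λ m → if does (m ≟ k) then r else 0#
    ; support = k ∷ []
    ; finite = λ {m} m∉ → elsewhere m λ eq → m∉ (here eq)
    }
    where
    elsewhere : ∀ m → ¬ (m ≡ k) → (if does (m ≟ k) then r else 0#) ≈ 0#
    elsewhere m m≢k rewrite dec-false (m ≟ k) m≢k = R.refl

  infixl 6 _⊕ₛ_
  _⊕ₛ_ : Poly → Poly → Poly
  p ⊕ₛ q = record
    { coeff = λ m → coeff p m R.+ coeff q m
    ; support = support p ++ support q
    ; finite = λ m∉ → R.trans
        (R.+-cong (finite p λ m∈ → m∉ (∈-++⁺ˡ m∈))
                  (finite q λ m∈ → m∉ (∈-++⁺ʳ (support p) m∈)))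
        (R.+-identityˡ 0#)
    }

  sum : List Carrier → Carrier
  sum = foldr R._+_ 0#

  infixl 7 _⊙ₛ_
  _⊙ₛ_ : Poly → Poly → Poly
  p ⊙ₛ q = record
    { coeff = λ m → sum (map (λ (k , l) → coeff p k R.* coeff q l) (splits m))
    ; support = cartesianProductWith _+ₑ_ (support p) (support q)
    ; finite = λ {m} m∉ → sum-0 (splits m) λ {k} {l} kl∈ → term-0 k l λ k∈ l∈ →
        m∉ (subst (_∈ _) (splits-sound m kl∈) (∈-cartesianProductWith⁺ _+ₑ_ k∈ l∈))
    }
    where
    open DecMembership _≟_ using (_∈?_)

    term-0 : ∀ k l → (k ∈ support p → l ∈ support q → ⊥) →
             coeff p k R.* coeff q l ≈ 0#
    term-0 k l ¬both with k ∈? support p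
    ... | no k∉  = R.trans (R.*-congʳ (finite p k∉)) (R.zeroˡ _)
    ... | yes k∈ = R.trans (R.*-congˡ (finite q (¬both k∈))) (R.zeroʳ _)

    sum-0 : ∀ kls → (∀ {k l} → (k , l) ∈ kls → coeff p k R.* coeff q l ≈ 0#) →
            sum (map (λ (k , l) → coeff p k R.* coeff q l) kls) ≈ 0#
    sum-0 []        _ = R.refl
    sum-0 (_ ∷ kls) h = R.trans
      (R.+-cong (h (here refl)) (sum-0 kls λ kl∈ → h (there kl∈)))
      (R.+-identityˡ 0#)

  ----------------------------------------------------------------------
  -- s-equivalence

  Ψ : Term → Poly
  Ψ 𝟎       = 0ₚ
  Ψ 𝟏       = single ε 1#
  Ψ (con r) = single ε r
  Ψ (var i) = single (unit i) 1#
  Ψ (t ⊞ u) = Ψ t ⊕ₛ Ψ u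
  Ψ (t ⊠ u) = Ψ t ⊙ₛ Ψ u

  infix 4 _≈ˢ_
  _≈ˢ_ : Term → Term → Set ℓ
  t ≈ˢ u = Ψ t ≈ₚ Ψ u

{-# OPTIONS --safe #-}

-- A term t over R acts as an R-linear functional: given a commutative
-- R-algebra A and Φ : ℕ₀^∞ → A, let ⟦ t ⟧ Φ be the sum of the coefficients of t
-- times the values of Φ at their exponents.  It is defined by recursion on t,
-- with ⟦ t ⊠ u ⟧ Φ = ⟦ t ⟧ (k ↦ ⟦ u ⟧ (l ↦ Φ (k + l))), so commutativity of ⊠
-- becomes a Fubini theorem, and all rules ET-1 – ET10 preserve ⟦ t ⟧.
-- For A = R and Φ the indicator of m it is the coefficient of Ψ t at m, so
-- f-equivalent terms are s-equivalent.  Conversely ⟦ t ⟧ Φ is determined by the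
-- coefficients of Ψ t, and for A the algebra of terms modulo f-equivalence and Φ
-- the monomials it is t itself.

module Submission where

open import Defs
open import Algebra.Bundles using (CommutativeRing; CommutativeSemiring)
import Algebra.Morphism.Construct.Identity as Identity
open import Algebra.Morphism.Structures using (IsSemiringHomomorphism)
import Algebra.Properties.CommutativeSemigroup as CommutativeSemigroupProperties
import Algebra.Properties.Semiring.Exp as Exp
open import Algebra.Structures.Biased using (IsCommutativeSemiringʳ)
open import Data.Bool.Base using (true; false; if_then_else_)
open import Data.List.Base using (List; []; _∷_; _++_; foldr; map; deduplicate)
open import Data.List.Membership.Propositional using (_∈_)
open import Data.List.Membership.Propositional.Properties
  using (∈-++⁺ˡ; ∈-++⁺ʳ; ∈-cartesianProductWith⁺; ∈-deduplicate⁺)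
import Data.List.Relation.Unary.All as All
open import Data.List.Relation.Unary.Any using (here; there)
open import Data.List.Relation.Unary.Unique.DecPropositional.Properties _≟_ using (deduplicate-!)
open import Data.List.Relation.Unary.Unique.Propositional using (Unique; []; _∷_)
open import Data.Nat.Base using (ℕ; zero; suc)
import Data.Nat.Properties as ℕ
open import Data.Product.Base using (_,_)
open import Function.Base using (_∘_; case_of_)
open import Function.Bundles using (_⇔_; mk⇔)
open import Level using (Level)
open import Relation.Binary.Construct.Closure.Symmetric
  using (SymClosure; fwd; bwd; gmap; symmetric)
open import Relation.Binary.Construct.Closure.Transitive using ([_]; _∷_) renaming (_++_ to _⁺++_)
import Relation.Binary.Construct.Closure.Transitive as Plus
open import Relation.Binary.PropositionalEquality using (_≡_; _≢_; cong; cong₂)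
import Relation.Binary.PropositionalEquality as ≡
import Relation.Binary.Reasoning.Setoid as SetoidReasoning
open import Relation.Binary.Structures using (IsEquivalence)
open import Relation.Nullary using (¬_; does; yes; no)
open import Relation.Nullary.Decidable using (dec-true; dec-false)

private variable
  a b x : Level

-- Addition of exponents.

padAdd-identityʳ : ∀ k → padAdd k [] ≡ k
padAdd-identityʳ []      = ≡.refl
padAdd-identityʳ (_ ∷ _) = ≡.refl

padAdd-comm : ∀ k l → padAdd k l ≡ padAdd l k
padAdd-comm []      l       = ≡.sym (padAdd-identityʳ l)
padAdd-comm (_ ∷ _) []      = ≡.refl
padAdd-comm (i ∷ k) (j ∷ l) = cong₂ _∷_ (ℕ.+-comm i j) (padAdd-comm k l)

padAdd-assoc : ∀ k l m → padAdd (padAdd k l) m ≡ padAdd k (padAdd l m)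
padAdd-assoc []      l       m       = ≡.refl
padAdd-assoc (_ ∷ _) []      m       = ≡.refl
padAdd-assoc (_ ∷ _) (_ ∷ _) []      = ≡.refl
padAdd-assoc (i ∷ k) (j ∷ l) (n ∷ m) = cong₂ _∷_ (ℕ.+-assoc i j n) (padAdd-assoc k l m)

+ₑ-comm : ∀ k l → k +ₑ l ≡ l +ₑ k
+ₑ-comm k l = seq-injective (padAdd-comm (seq k) (seq l))

+ₑ-assoc : ∀ k l m → (k +ₑ l) +ₑ m ≡ k +ₑ (l +ₑ m)
+ₑ-assoc k l m = seq-injective (padAdd-assoc (seq k) (seq l) (seq m))

-- Finite sums in a commutative semiring.

module Sums (A : CommutativeSemiring a b) where
  open CommutativeSemiring A renaming (Carrier to C)

  private variable
    X : Set x

  ∑ : List X → (X → C) → C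
  ∑ xs f = foldr _+_ 0# (map f xs)

  ∑-cong : ∀ (xs : List X) {f g} → (∀ x → f x ≈ g x) → ∑ xs f ≈ ∑ xs g
  ∑-cong []       f≈g = refl
  ∑-cong (x ∷ xs) f≈g = +-cong (f≈g x) (∑-cong xs f≈g)

  ∑-zero : ∀ (xs : List X) {f} → (∀ {x} → x ∈ xs → f x ≈ 0#) → ∑ xs f ≈ 0#
  ∑-zero []       f≈0 = refl
  ∑-zero (x ∷ xs) f≈0 =
    trans (+-cong (f≈0 (here ≡.refl)) (∑-zero xs (f≈0 ∘ there))) (+-identityˡ 0#)

  ∑-select : ∀ {xs : List X} {y} f → Unique xs → y ∈ xs →
             (∀ {x} → x ≢ y → f x ≈ 0#) → ∑ xs f ≈ f y
  ∑-select f (y∉xs ∷ _) (here ≡.refl) f≈0 =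
    trans (+-congˡ (∑-zero _ λ x∈ → f≈0 λ x≡y → All.lookup y∉xs x∈ (≡.sym x≡y))) (+-identityʳ _)
  ∑-select f (x∉xs ∷ !xs) (there y∈) f≈0 =
    trans (+-cong (f≈0 (All.lookup x∉xs y∈)) (∑-select f !xs y∈ f≈0)) (+-identityˡ _)

-- Monomials in a commutative semiring.

module Monomials (A : CommutativeSemiring a b) where
  open CommutativeSemiring A renaming (Carrier to C)
  open CommutativeSemigroupProperties *-commutativeSemigroup using (interchange)
  open Exp semiring using (_^_; ^-homo-*)

  -- The recursion shifts the assignment `x` instead of carrying an index, and runs on plain lists
  -- so that tails need no canonicity proof.
  monomial : (ℕ → C) → List ℕ → C
  monomial x []      = 1#
  monomial x (i ∷ k) = x 0 ^ i * monomial (x ∘ suc) k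

  monomial-unit : ∀ x i → monomial x (seq (unit i)) ≈ x i
  monomial-unit x zero    = trans (*-identityʳ _) (*-identityʳ _)
  monomial-unit x (suc i) = trans (*-identityˡ _) (monomial-unit (x ∘ suc) i)

  monomial-padAdd : ∀ x k l → monomial x (padAdd k l) ≈ monomial x k * monomial x l
  monomial-padAdd x []      l       = sym (*-identityˡ _)
  monomial-padAdd x (i ∷ k) []      = sym (*-identityʳ _)
  monomial-padAdd x (i ∷ k) (j ∷ l) =
    trans (*-cong (^-homo-* (x 0) i j) (monomial-padAdd (x ∘ suc) k l))
          (interchange _ _ _ _)

module _ {c ℓ} (R : CommutativeRing c ℓ) where

  open RingTerms R
  private
    module R = CommutativeRing R
    rawSemiringᴿ = CommutativeSemiring.rawSemiring R.commutativeSemiring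

  -- The pairing of a term with a function on exponents.

  module Pairing (A : CommutativeSemiring a b) {h : R.Carrier → CommutativeSemiring.Carrier A}
    (h-hom : IsSemiringHomomorphism rawSemiringᴿ (CommutativeSemiring.rawSemiring A) h) where

    open CommutativeSemiring A renaming (Carrier to C)
    open IsSemiringHomomorphism h-hom using (+-homo; *-homo; 0#-homo; 1#-homo)
      renaming (⟦⟧-cong to h-cong)
    open CommutativeSemigroupProperties +-commutativeSemigroup using (interchange)
    open CommutativeSemigroupProperties *-commutativeSemigroup using (x∙yz≈y∙xz)
    open Sums A
    open SetoidReasoning setoid

    infix 9 ⟦_⟧_
    -- Scalars act through `h`. The target is a semiring because the term algebra, one of its two
    -- instances, has no symbol for negation.
    ⟦_⟧_ : Term → (ℕ₀^∞ → C) → C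
    ⟦ 𝟎 ⟧     Φ = 0#
    ⟦ 𝟏 ⟧     Φ = Φ ε
    ⟦ con r ⟧ Φ = h r * Φ ε
    ⟦ var i ⟧ Φ = Φ (unit i)
    ⟦ t ⊞ u ⟧ Φ = ⟦ t ⟧ Φ + ⟦ u ⟧ Φ
    ⟦ t ⊠ u ⟧ Φ = ⟦ t ⟧ λ k → ⟦ u ⟧ λ l → Φ (k +ₑ l)

    -- The support list of `Ψ t` is built by the same recursion as the pairing. This locality later
    -- permits replacing `Φ` by a finite sum that agrees with it only on a finite list.
    ⟦⟧-cong-support : ∀ t {Φ Φ′} → (∀ {k} → k ∈ support (Ψ t) → Φ k ≈ Φ′ k) → ⟦ t ⟧ Φ ≈ ⟦ t ⟧ Φ′
    ⟦⟧-cong-support 𝟎       Φ≈Φ′ = refl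
    ⟦⟧-cong-support 𝟏       Φ≈Φ′ = Φ≈Φ′ (here ≡.refl)
    ⟦⟧-cong-support (con r) Φ≈Φ′ = *-congˡ (Φ≈Φ′ (here ≡.refl))
    ⟦⟧-cong-support (var i) Φ≈Φ′ = Φ≈Φ′ (here ≡.refl)
    ⟦⟧-cong-support (t ⊞ u) Φ≈Φ′ =
      +-cong (⟦⟧-cong-support t (Φ≈Φ′ ∘ ∈-++⁺ˡ))
             (⟦⟧-cong-support u (Φ≈Φ′ ∘ ∈-++⁺ʳ (support (Ψ t))))
    ⟦⟧-cong-support (t ⊠ u) Φ≈Φ′ =
      ⟦⟧-cong-support t λ k∈ → ⟦⟧-cong-support u λ l∈ →
        Φ≈Φ′ (∈-cartesianProductWith⁺ _+ₑ_ k∈ l∈)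

    ⟦⟧-cong : ∀ t {Φ Φ′} → (∀ k → Φ k ≈ Φ′ k) → ⟦ t ⟧ Φ ≈ ⟦ t ⟧ Φ′
    ⟦⟧-cong t Φ≈Φ′ = ⟦⟧-cong-support t λ {k} _ → Φ≈Φ′ k

    ⟦⟧-zero : ∀ t → ⟦ t ⟧ (λ _ → 0#) ≈ 0#
    ⟦⟧-zero 𝟎       = refl
    ⟦⟧-zero 𝟏       = refl
    ⟦⟧-zero (con r) = zeroʳ (h r)
    ⟦⟧-zero (var i) = refl
    ⟦⟧-zero (t ⊞ u) = trans (+-cong (⟦⟧-zero t) (⟦⟧-zero u)) (+-identityˡ 0#)
    ⟦⟧-zero (t ⊠ u) = trans (⟦⟧-cong t λ _ → ⟦⟧-zero u) (⟦⟧-zero t)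

    ⟦⟧-+ : ∀ t Φ Φ′ → ⟦ t ⟧ (λ k → Φ k + Φ′ k) ≈ ⟦ t ⟧ Φ + ⟦ t ⟧ Φ′
    ⟦⟧-+ 𝟎       Φ Φ′ = sym (+-identityˡ 0#)
    ⟦⟧-+ 𝟏       Φ Φ′ = refl
    ⟦⟧-+ (con r) Φ Φ′ = distribˡ (h r) (Φ ε) (Φ′ ε)
    ⟦⟧-+ (var i) Φ Φ′ = refl
    ⟦⟧-+ (t ⊞ u) Φ Φ′ = trans (+-cong (⟦⟧-+ t Φ Φ′) (⟦⟧-+ u Φ Φ′)) (interchange _ _ _ _)
    ⟦⟧-+ (t ⊠ u) Φ Φ′ = trans (⟦⟧-cong t λ _ → ⟦⟧-+ u _ _) (⟦⟧-+ t _ _)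

    ⟦⟧-*ˡ : ∀ t a Φ → ⟦ t ⟧ (λ k → a * Φ k) ≈ a * ⟦ t ⟧ Φ
    ⟦⟧-*ˡ 𝟎       a Φ = sym (zeroʳ a)
    ⟦⟧-*ˡ 𝟏       a Φ = refl
    ⟦⟧-*ˡ (con r) a Φ = x∙yz≈y∙xz (h r) a (Φ ε)
    ⟦⟧-*ˡ (var i) a Φ = refl
    ⟦⟧-*ˡ (t ⊞ u) a Φ = trans (+-cong (⟦⟧-*ˡ t a Φ) (⟦⟧-*ˡ u a Φ)) (sym (distribˡ a _ _))
    ⟦⟧-*ˡ (t ⊠ u) a Φ = trans (⟦⟧-cong t λ _ → ⟦⟧-*ˡ u a _) (⟦⟧-*ˡ t a _)

    ⟦⟧-*ʳ : ∀ t Φ a → ⟦ t ⟧ (λ k → Φ k * a) ≈ ⟦ t ⟧ Φ * a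
    ⟦⟧-*ʳ t Φ a = begin
      ⟦ t ⟧ (λ k → Φ k * a)  ≈⟨ ⟦⟧-cong t (λ k → *-comm (Φ k) a) ⟩
      ⟦ t ⟧ (λ k → a * Φ k)  ≈⟨ ⟦⟧-*ˡ t a Φ ⟩
      a * ⟦ t ⟧ Φ            ≈⟨ *-comm a _ ⟩
      ⟦ t ⟧ Φ * a            ∎

    ⟦⟧-⊗ : ∀ t u Φ Θ → ⟦ t ⟧ (λ k → ⟦ u ⟧ λ l → Φ k * Θ l) ≈ ⟦ t ⟧ Φ * ⟦ u ⟧ Θ
    ⟦⟧-⊗ t u Φ Θ = trans (⟦⟧-cong t λ k → ⟦⟧-*ˡ u (Φ k) Θ) (⟦⟧-*ʳ t Φ _)

    ⟦⟧-∑ : ∀ {X : Set x} t (xs : List X) (F : X → ℕ₀^∞ → C) →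
           ⟦ t ⟧ (λ k → ∑ xs λ x → F x k) ≈ ∑ xs λ x → ⟦ t ⟧ F x
    ⟦⟧-∑ t []       F = ⟦⟧-zero t
    ⟦⟧-∑ t (x ∷ xs) F = trans (⟦⟧-+ t (F x) _) (+-congˡ (⟦⟧-∑ t xs F))

    -- Induction on `t` alone: each case needs only linearity of the pairing with `u`. For a
    -- product, `u` is moved past one factor at a time.
    ⟦⟧-fubini : ∀ t u (F : ℕ₀^∞ → ℕ₀^∞ → C) →
                ⟦ t ⟧ (λ k → ⟦ u ⟧ λ l → F k l) ≈ ⟦ u ⟧ (λ l → ⟦ t ⟧ λ k → F k l)
    ⟦⟧-fubini 𝟎        u F = sym (⟦⟧-zero u)
    ⟦⟧-fubini 𝟏        u F = refl
    ⟦⟧-fubini (con r)  u F = sym (⟦⟧-*ˡ u (h r) (F ε))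
    ⟦⟧-fubini (var i)  u F = refl
    ⟦⟧-fubini (t ⊞ t′) u F = trans (+-cong (⟦⟧-fubini t u F) (⟦⟧-fubini t′ u F)) (sym (⟦⟧-+ u _ _))
    ⟦⟧-fubini (t ⊠ t′) u F =
      trans (⟦⟧-cong t λ _ → ⟦⟧-fubini t′ u _) (⟦⟧-fubini t u _)

    -- Each rule becomes a law of `A`, a law of exponent addition, or linearity. `Φ` stays
    -- universally quantified because a replacement inside a factor of `⊠` is paired with a
    -- different function.
    ⟦⟧-⟶ : ∀ {t t′} → t ⟶ t′ → ∀ Φ → ⟦ t ⟧ Φ ≈ ⟦ t′ ⟧ Φ
    ⟦⟧-⟶ ET-1           Φ = sym (trans (*-congʳ 0#-homo) (zeroˡ _))
    ⟦⟧-⟶ ET0            Φ = sym (trans (*-congʳ 1#-homo) (*-identityˡ _))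
    ⟦⟧-⟶ (ET1 r s)      Φ = sym (trans (*-congʳ (+-homo r s)) (distribʳ _ _ _))
    ⟦⟧-⟶ (ET2 r s)      Φ = sym (trans (*-congʳ (*-homo r s)) (*-assoc _ _ _))
    ⟦⟧-⟶ (ET3 u)        Φ = +-identityˡ _
    -- `ε +ₑ l` reduces to `l`.
    ⟦⟧-⟶ (ET4 u)        Φ = refl
    ⟦⟧-⟶ (ET5 u u′)     Φ = +-comm _ _
    ⟦⟧-⟶ (ET6 u u′)     Φ = trans (⟦⟧-fubini u u′ _)
      (⟦⟧-cong u′ λ l → ⟦⟧-cong u λ k → reflexive (cong Φ (+ₑ-comm k l)))
    ⟦⟧-⟶ (ET7 u u′ u″)  Φ = sym (+-assoc _ _ _)
    ⟦⟧-⟶ (ET8 u u′ u″)  Φ =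
      ⟦⟧-cong u λ k → ⟦⟧-cong u′ λ l → ⟦⟧-cong u″ λ m →
        reflexive (cong Φ (≡.sym (+ₑ-assoc k l m)))
    ⟦⟧-⟶ (ET9 u u′ u″)  Φ = ⟦⟧-+ u _ _
    ⟦⟧-⟶ (ET10 u)       Φ = refl

    ⟦⟧-⇝ : ∀ {t t′} → t ⇝ t′ → ∀ Φ → ⟦ t ⟧ Φ ≈ ⟦ t′ ⟧ Φ
    ⟦⟧-⇝ (root v⟶v′)   Φ = ⟦⟧-⟶ v⟶v′ Φ
    ⟦⟧-⇝ (⊞ˡ u t⇝t′)   Φ = +-congʳ (⟦⟧-⇝ t⇝t′ Φ)
    ⟦⟧-⇝ (⊞ʳ t u⇝u′)   Φ = +-congˡ (⟦⟧-⇝ u⇝u′ Φ)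
    ⟦⟧-⇝ (⊠ˡ u t⇝t′)   Φ = ⟦⟧-⇝ t⇝t′ _
    ⟦⟧-⇝ (⊠ʳ t u⇝u′)   Φ = ⟦⟧-cong t λ _ → ⟦⟧-⇝ u⇝u′ _

    ⟦⟧-≐ : ∀ {t t′} → t ≐ t′ → ∀ Φ → ⟦ t ⟧ Φ ≈ ⟦ t′ ⟧ Φ
    ⟦⟧-≐ 𝟎             Φ = refl
    ⟦⟧-≐ 𝟏             Φ = refl
    ⟦⟧-≐ (con r≈s)     Φ = *-congʳ (h-cong r≈s)
    ⟦⟧-≐ (var i)       Φ = refl
    ⟦⟧-≐ (t≐t′ ⊞ u≐u′) Φ = +-cong (⟦⟧-≐ t≐t′ Φ) (⟦⟧-≐ u≐u′ Φ)
    ⟦⟧-≐ (_⊠_ {t = t} t≐t′ u≐u′) Φ = trans (⟦⟧-cong t λ _ → ⟦⟧-≐ u≐u′ _) (⟦⟧-≐ t≐t′ _)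

    ⟦⟧-~ : ∀ {t t′} → t ~ t′ → ∀ Φ → ⟦ t ⟧ Φ ≈ ⟦ t′ ⟧ Φ
    ⟦⟧-~ (_ , _ , t≐v , v⇄v′ , v′≐t′) Φ =
      trans (⟦⟧-≐ t≐v Φ) (trans (step v⇄v′) (⟦⟧-≐ v′≐t′ Φ))
      where
      step : ∀ {v v′} → SymClosure _⇝_ v v′ → ⟦ v ⟧ Φ ≈ ⟦ v′ ⟧ Φ
      step (fwd v⇝v′) = ⟦⟧-⇝ v⇝v′ Φ
      step (bwd v′⇝v) = sym (⟦⟧-⇝ v′⇝v Φ)

    ⟦⟧-≈ᶠ : ∀ {t u} → t ≈ᶠ u → ∀ Φ → ⟦ t ⟧ Φ ≈ ⟦ u ⟧ Φ
    ⟦⟧-≈ᶠ [ t~u ]       Φ = ⟦⟧-~ t~u Φ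
    ⟦⟧-≈ᶠ (t~v ∷ v≈ᶠu) Φ = trans (⟦⟧-~ t~v Φ) (⟦⟧-≈ᶠ v≈ᶠu Φ)

  -- Coefficients as values of the pairing

  -- The comparison is written in the same order as in `single`, so the coefficients of `𝟏` and of
  -- variables agree with the pairing by computation.
  δ : ℕ₀^∞ → ℕ₀^∞ → R.Carrier
  δ m k = if does (m ≟ k) then R.1# else R.0#

  δ-≡ : ∀ m → δ m m R.≈ R.1#
  δ-≡ m rewrite dec-true (m ≟ m) ≡.refl = R.refl

  δ-≢ : ∀ {m k} → m ≢ k → δ m k R.≈ R.0#
  δ-≢ {m} {k} m≢k rewrite dec-false (m ≟ k) m≢k = R.refl

  module _ where
    open Sums R.commutativeSemiring
    open SetoidReasoning R.setoid

    δ-pair-≢ : ∀ {k k′ l l′} → (k′ , l′) ≢ (k , l) → δ k′ k R.* δ l′ l R.≈ R.0#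
    δ-pair-≢ {k} {k′} ≢kl with k′ ≟ k
    ... | no  k′≢k   = R.trans (R.*-congʳ (δ-≢ k′≢k)) (R.zeroˡ _)
    ... | yes ≡.refl = R.trans (R.*-congˡ (δ-≢ (≢kl ∘ cong (k ,_)))) (R.zeroʳ _)

    -- A summand survives only at the pair `(k , l)`, which `splits m` contains exactly once if `m`
    -- is `k +ₑ l` and not at all otherwise.
    δ-+ₑ : ∀ m k l → δ m (k +ₑ l) R.≈ ∑ (splits m) λ (k′ , l′) → δ k′ k R.* δ l′ l
    δ-+ₑ m k l = case m ≟ (k +ₑ l) of λ where
      (yes ≡.refl) → begin
        δ (k +ₑ l) (k +ₑ l)  ≈⟨ δ-≡ (k +ₑ l) ⟩
        R.1#                 ≈⟨ R.*-identityˡ R.1# ⟨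
        R.1# R.* R.1#        ≈⟨ R.*-cong (δ-≡ k) (δ-≡ l) ⟨
        δ k k R.* δ l l      ≈⟨ ∑-select _ (splits-unique (k +ₑ l)) (splits-complete k l) δ-pair-≢ ⟨
        ∑ (splits (k +ₑ l)) (λ (k′ , l′) → δ k′ k R.* δ l′ l) ∎
      (no m≢k+l) → R.trans (δ-≢ m≢k+l) (R.sym (∑-zero (splits m) λ {(k′ , l′)} kl∈ →
        δ-pair-≢ {k} {k′} {l} {l′} λ { ≡.refl → m≢k+l (≡.sym (splits-sound m kl∈)) }))

    if-*ˡ : ∀ r b → (if b then r else R.0#) R.≈ r R.* (if b then R.1# else R.0#)
    if-*ˡ r true  = R.sym (R.*-identityʳ r)
    if-*ˡ r false = R.sym (R.zeroʳ r)

    open Pairing R.commutativeSemiring (Identity.isSemiringHomomorphism rawSemiringᴿ R.refl)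

    -- For a product, the convolution is a finite sum of products of pairings. Each product is an
    -- iterated pairing, linearity moves the sum inside, and there it collapses to a single
    -- indicator by `δ-+ₑ`.
    coeff-Ψ : ∀ t m → coeff (Ψ t) m R.≈ ⟦ t ⟧ δ m
    coeff-Ψ 𝟎       m = R.refl
    coeff-Ψ 𝟏       m = R.refl
    coeff-Ψ (con r) m = if-*ˡ r (does (m ≟ ε))
    coeff-Ψ (var i) m = R.refl
    coeff-Ψ (t ⊞ u) m = R.+-cong (coeff-Ψ t m) (coeff-Ψ u m)
    coeff-Ψ (t ⊠ u) m = begin
      ∑ (splits m) (λ (k , l) → coeff (Ψ t) k R.* coeff (Ψ u) l)
        ≈⟨ ∑-cong (splits m) (λ (k , l) → R.*-cong (coeff-Ψ t k) (coeff-Ψ u l)) ⟩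
      ∑ (splits m) (λ (k , l) → ⟦ t ⟧ δ k R.* ⟦ u ⟧ δ l)
        ≈⟨ ∑-cong (splits m) (λ (k , l) → ⟦⟧-⊗ t u (δ k) (δ l)) ⟨
      ∑ (splits m) (λ (k , l) → ⟦ t ⟧ λ k′ → ⟦ u ⟧ λ l′ → δ k k′ R.* δ l l′)
        ≈⟨ ⟦⟧-∑ t (splits m) _ ⟨
      ⟦ t ⟧ (λ k′ → ∑ (splits m) λ (k , l) → ⟦ u ⟧ λ l′ → δ k k′ R.* δ l l′)
        ≈⟨ ⟦⟧-cong t (λ k′ → ⟦⟧-∑ u (splits m) _) ⟨
      ⟦ t ⟧ (λ k′ → ⟦ u ⟧ λ l′ → ∑ (splits m) λ (k , l) → δ k k′ R.* δ l l′)
        ≈⟨ ⟦⟧-cong t (λ k′ → ⟦⟧-cong u λ l′ → δ-+ₑ m k′ l′) ⟨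
      ⟦ t ⟧ (λ k′ → ⟦ u ⟧ λ l′ → δ m (k′ +ₑ l′)) ∎

    ≈ᶠ⇒≈ˢ : ∀ {t u} → t ≈ᶠ u → t ≈ˢ u
    ≈ᶠ⇒≈ˢ {t} {u} t≈ᶠu m = begin
      coeff (Ψ t) m  ≈⟨ coeff-Ψ t m ⟩
      ⟦ t ⟧ δ m      ≈⟨ ⟦⟧-≈ᶠ t≈ᶠu (δ m) ⟩
      ⟦ u ⟧ δ m      ≈⟨ coeff-Ψ u m ⟨
      coeff (Ψ u) m  ∎

  -- Pairings in terms of coefficients.

  module _ (A : CommutativeSemiring a b) {h : R.Carrier → CommutativeSemiring.Carrier A}
    (h-hom : IsSemiringHomomorphism rawSemiringᴿ (CommutativeSemiring.rawSemiring A) h) where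

    open CommutativeSemiring A renaming (Carrier to C)
    open IsSemiringHomomorphism h-hom using (+-homo; *-homo; 0#-homo; 1#-homo)
      renaming (⟦⟧-cong to h-cong)
    open Sums A
    open Pairing A h-hom
    open SetoidReasoning setoid
    private module P = Pairing R.commutativeSemiring
                         (Identity.isSemiringHomomorphism rawSemiringᴿ R.refl)

    -- Naturality in the algebra: it carries the description of coefficients by `δ` from `R` over to
    -- `A`.
    ⟦⟧-homo : ∀ t φ → ⟦ t ⟧ (h ∘ φ) ≈ h (P.⟦ t ⟧ φ)
    ⟦⟧-homo 𝟎       φ = sym 0#-homo
    ⟦⟧-homo 𝟏       φ = refl
    ⟦⟧-homo (con r) φ = sym (*-homo r (φ ε))
    ⟦⟧-homo (var i) φ = refl
    ⟦⟧-homo (t ⊞ u) φ = trans (+-cong (⟦⟧-homo t φ) (⟦⟧-homo u φ)) (sym (+-homo _ _))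
    ⟦⟧-homo (t ⊠ u) φ = trans (⟦⟧-cong t λ _ → ⟦⟧-homo u _) (⟦⟧-homo t _)

    -- On `ms`, `Φ` is the combination of indicators with weights `Φ m`, and linearity pulls sum and
    -- weights out. Leaving `ms` free lets two terms be expanded over the same list.
    ⟦⟧-coeff : ∀ t Φ {ms} → Unique ms → (∀ {k} → k ∈ support (Ψ t) → k ∈ ms) →
               ⟦ t ⟧ Φ ≈ ∑ ms λ m → h (coeff (Ψ t) m) * Φ m
    ⟦⟧-coeff t Φ {ms} !ms ⊆ms = begin
      ⟦ t ⟧ Φ                                    ≈⟨ ⟦⟧-cong-support t (select ∘ ⊆ms) ⟨
      ⟦ t ⟧ (λ k → ∑ ms λ m → h (δ m k) * Φ m)   ≈⟨ ⟦⟧-∑ t ms _ ⟩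
      ∑ ms (λ m → ⟦ t ⟧ λ k → h (δ m k) * Φ m)   ≈⟨ ∑-cong ms (λ m → ⟦⟧-*ʳ t (h ∘ δ m) (Φ m)) ⟩
      ∑ ms (λ m → ⟦ t ⟧ (h ∘ δ m) * Φ m)         ≈⟨ ∑-cong ms (λ m → *-congʳ (coefficient m)) ⟩
      ∑ ms (λ m → h (coeff (Ψ t) m) * Φ m)       ∎
      where
      select : ∀ {k} → k ∈ ms → ∑ ms (λ m → h (δ m k) * Φ m) ≈ Φ k
      select {k} k∈ = begin
        ∑ ms (λ m → h (δ m k) * Φ m)  ≈⟨ ∑-select _ !ms k∈ (λ m≢k →
          trans (*-congʳ (trans (h-cong (δ-≢ m≢k)) 0#-homo)) (zeroˡ _)) ⟩
        h (δ k k) * Φ k               ≈⟨ *-congʳ (trans (h-cong (δ-≡ k)) 1#-homo) ⟩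
        1# * Φ k                      ≈⟨ *-identityˡ (Φ k) ⟩
        Φ k                           ∎

      coefficient : ∀ m → ⟦ t ⟧ (h ∘ δ m) ≈ h (coeff (Ψ t) m)
      coefficient m = trans (⟦⟧-homo t (δ m)) (h-cong (R.sym (coeff-Ψ t m)))

    ⟦⟧-≈ˢ : ∀ t u → t ≈ˢ u → ∀ Φ → ⟦ t ⟧ Φ ≈ ⟦ u ⟧ Φ
    ⟦⟧-≈ˢ t u t≈ˢu Φ = begin
      ⟦ t ⟧ Φ                               ≈⟨ ⟦⟧-coeff t Φ !ms (∈-deduplicate⁺ _≟_ ∘ ∈-++⁺ˡ) ⟩
      ∑ ms (λ m → h (coeff (Ψ t) m) * Φ m)  ≈⟨ ∑-cong ms (λ m → *-congʳ (h-cong (t≈ˢu m))) ⟩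
      ∑ ms (λ m → h (coeff (Ψ u) m) * Φ m)  ≈⟨ ⟦⟧-coeff u Φ !ms
        (∈-deduplicate⁺ _≟_ ∘ ∈-++⁺ʳ (support (Ψ t))) ⟨
      ⟦ u ⟧ Φ                               ∎
      where
      -- One list for both terms makes the expansions comparable summand by summand; duplicates
      -- would count an exponent more than once.
      ms : List ℕ₀^∞
      ms = deduplicate _≟_ (support (Ψ t) ++ support (Ψ u))

      !ms : Unique ms
      !ms = deduplicate-! (support (Ψ t) ++ support (Ψ u))

  -- Terms modulo f-equivalence

  ≐-refl : ∀ {t} → t ≐ t
  ≐-refl {𝟎}     = 𝟎
  ≐-refl {𝟏}     = 𝟏
  ≐-refl {con r} = con R.refl
  ≐-refl {var i} = var i
  ≐-refl {t ⊞ u} = ≐-refl ⊞ ≐-refl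
  ≐-refl {t ⊠ u} = ≐-refl ⊠ ≐-refl

  ≐-sym : ∀ {t u} → t ≐ u → u ≐ t
  ≐-sym 𝟎             = 𝟎
  ≐-sym 𝟏             = 𝟏
  ≐-sym (con r≈s)     = con (R.sym r≈s)
  ≐-sym (var i)       = var i
  ≐-sym (t≐t′ ⊞ u≐u′) = ≐-sym t≐t′ ⊞ ≐-sym u≐u′
  ≐-sym (t≐t′ ⊠ u≐u′) = ≐-sym t≐t′ ⊠ ≐-sym u≐u′

  ~-sym : ∀ {t u} → t ~ u → u ~ t
  ~-sym (_ , _ , t≐v , v⇄v′ , v′≐u) = _ , _ , ≐-sym v′≐u , symmetric _⇝_ v⇄v′ , ≐-sym t≐v

  ≈ᶠ-sym : ∀ {t u} → t ≈ᶠ u → u ≈ᶠ t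
  ≈ᶠ-sym = Plus.symmetric _~_ ~-sym

  ⟶⇒≈ᶠ : ∀ {t u} → t ⟶ u → t ≈ᶠ u
  ⟶⇒≈ᶠ t⟶u = [ _ , _ , ≐-refl , fwd (root t⟶u) , ≐-refl ]

  -- A chain has at least one step and every step performs a replacement, so the chain goes to
  -- `𝟎 ⊞ t` and back, and the last step absorbs the identity of words.
  ≐⇒≈ᶠ : ∀ {t u} → t ≐ u → t ≈ᶠ u
  ≐⇒≈ᶠ {t} t≐u =
    (_ , _ , ≐-refl , bwd (root (ET3 t)) , ≐-refl) ∷ [ _ , _ , ≐-refl , fwd (root (ET3 t)) , t≐u ]

  ≈ᶠ-refl : ∀ {t} → t ≈ᶠ t
  ≈ᶠ-refl = ≐⇒≈ᶠ ≐-refl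

  ≈ᶠ-map : (f : Term → Term) → (∀ {t u} → t ≐ u → f t ≐ f u) → (∀ {t u} → t ⇝ u → f t ⇝ f u) →
           ∀ {t u} → t ≈ᶠ u → f t ≈ᶠ f u
  ≈ᶠ-map f f-≐ f-⇝ = go
    where
    step : ∀ {t u} → t ~ u → f t ~ f u
    step (_ , _ , t≐v , v⇄v′ , v′≐u) = _ , _ , f-≐ t≐v , gmap f f-⇝ v⇄v′ , f-≐ v′≐u

    go : ∀ {t u} → t ≈ᶠ u → f t ≈ᶠ f u
    go [ t~u ]        = [ step t~u ]
    go (t~v ∷ v≈ᶠu) = step t~v ∷ go v≈ᶠu

  ⊞-cong : ∀ {t t′ u u′} → t ≈ᶠ t′ → u ≈ᶠ u′ → t ⊞ u ≈ᶠ t′ ⊞ u′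
  ⊞-cong {t′ = t′} {u} t≈t′ u≈u′ =
    ≈ᶠ-map (_⊞ u) (_⊞ ≐-refl) (⊞ˡ u) t≈t′ ⁺++ ≈ᶠ-map (t′ ⊞_) (≐-refl ⊞_) (⊞ʳ t′) u≈u′

  ⊠-cong : ∀ {t t′ u u′} → t ≈ᶠ t′ → u ≈ᶠ u′ → t ⊠ u ≈ᶠ t′ ⊠ u′
  ⊠-cong {t′ = t′} {u} t≈t′ u≈u′ =
    ≈ᶠ-map (_⊠ u) (_⊠ ≐-refl) (⊠ˡ u) t≈t′ ⁺++ ≈ᶠ-map (t′ ⊠_) (≐-refl ⊠_) (⊠ʳ t′) u≈u′

  -- The quotient is a setoid on terms. Rules `ET3` to `ET10` supply the semiring axioms, with `ET5`
  -- and `ET6` giving the mirrored forms.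
  termSemiring : CommutativeSemiring _ _
  termSemiring = record
    { Carrier = Term
    ; _≈_ = _≈ᶠ_
    ; _+_ = _⊞_
    ; _*_ = _⊠_
    ; 0# = 𝟎
    ; 1# = 𝟏
    ; isCommutativeSemiring = IsCommutativeSemiringʳ.isCommutativeSemiring record
      { +-isCommutativeMonoid = record
        { isMonoid = record
          { isSemigroup = record
            { isMagma = record { isEquivalence = isEquivalence ; ∙-cong = ⊞-cong }
            ; assoc = λ t u v → ≈ᶠ-sym (⟶⇒≈ᶠ (ET7 t u v))
            }
          ; identity = (λ t → ⟶⇒≈ᶠ (ET3 t)) , λ t → ⟶⇒≈ᶠ (ET5 t 𝟎) ⁺++ ⟶⇒≈ᶠ (ET3 t)
          }
        ; comm = λ t u → ⟶⇒≈ᶠ (ET5 t u)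
        }
      ; *-isCommutativeMonoid = record
        { isMonoid = record
          { isSemigroup = record
            { isMagma = record { isEquivalence = isEquivalence ; ∙-cong = ⊠-cong }
            ; assoc = λ t u v → ≈ᶠ-sym (⟶⇒≈ᶠ (ET8 t u v))
            }
          ; identity = (λ t → ⟶⇒≈ᶠ (ET4 t)) , λ t → ⟶⇒≈ᶠ (ET6 t 𝟏) ⁺++ ⟶⇒≈ᶠ (ET4 t)
          }
        ; comm = λ t u → ⟶⇒≈ᶠ (ET6 t u)
        }
      ; distribˡ = λ t u v → ⟶⇒≈ᶠ (ET9 t u v)
      ; zeroʳ = λ t → ⟶⇒≈ᶠ (ET6 t 𝟎) ⁺++ ⟶⇒≈ᶠ (ET10 t)
      }
    }
    where
    isEquivalence : IsEquivalence _≈ᶠ_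
    isEquivalence = record { refl = ≈ᶠ-refl ; sym = ≈ᶠ-sym ; trans = _⁺++_ }

  -- Rules `ET-1` to `ET2`, read from right to left, are the homomorphism laws.
  con-isSemiringHomomorphism :
    IsSemiringHomomorphism rawSemiringᴿ (CommutativeSemiring.rawSemiring termSemiring) con
  con-isSemiringHomomorphism = record
    { isNearSemiringHomomorphism = record
      { +-isMonoidHomomorphism = record
        { isMagmaHomomorphism = record
          { isRelHomomorphism = record { cong = ≐⇒≈ᶠ ∘ con }
          ; homo = λ r s → ≈ᶠ-sym (⟶⇒≈ᶠ (ET1 r s))
          }
        ; ε-homo = ≈ᶠ-sym (⟶⇒≈ᶠ ET-1)
        }
      ; *-homo = λ r s → ≈ᶠ-sym (⟶⇒≈ᶠ (ET2 r s))
      }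
    ; 1#-homo = ≈ᶠ-sym (⟶⇒≈ᶠ ET0)
    }

  -- Recovering a term from its monomials.

  open Monomials termSemiring
  open CommutativeSemiring termSemiring using (setoid; *-identityʳ)
  open Pairing termSemiring con-isSemiringHomomorphism
  open SetoidReasoning setoid

  monomialTerm : ℕ₀^∞ → Term
  monomialTerm = monomial var ∘ seq

  -- The left side plays the role of a normal form of `t`. For a product, multiplicativity of
  -- monomials splits the iterated pairing into the product of the two pairings.
  ⟦⟧-monomialTerm : ∀ t → ⟦ t ⟧ monomialTerm ≈ᶠ t
  ⟦⟧-monomialTerm 𝟎       = ≈ᶠ-refl
  ⟦⟧-monomialTerm 𝟏       = ≈ᶠ-refl
  ⟦⟧-monomialTerm (con r) = *-identityʳ (con r)
  ⟦⟧-monomialTerm (var i) = monomial-unit var i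
  ⟦⟧-monomialTerm (t ⊞ u) = ⊞-cong (⟦⟧-monomialTerm t) (⟦⟧-monomialTerm u)
  ⟦⟧-monomialTerm (t ⊠ u) = begin
    ⟦ t ⟧ (λ k → ⟦ u ⟧ λ l → monomialTerm (k +ₑ l))
      ≈⟨ ⟦⟧-cong t (λ k → ⟦⟧-cong u λ l → monomial-padAdd var (seq k) (seq l)) ⟩
    ⟦ t ⟧ (λ k → ⟦ u ⟧ λ l → monomialTerm k ⊠ monomialTerm l)
      ≈⟨ ⟦⟧-⊗ t u monomialTerm monomialTerm ⟩
    ⟦ t ⟧ monomialTerm ⊠ ⟦ u ⟧ monomialTerm
      ≈⟨ ⊠-cong (⟦⟧-monomialTerm t) (⟦⟧-monomialTerm u) ⟩
    t ⊠ u ∎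

  ≈ˢ⇒≈ᶠ : ∀ t u → t ≈ˢ u → t ≈ᶠ u
  ≈ˢ⇒≈ᶠ t u t≈ˢu = begin
    t                   ≈⟨ ⟦⟧-monomialTerm t ⟨
    ⟦ t ⟧ monomialTerm  ≈⟨ ⟦⟧-≈ˢ termSemiring con-isSemiringHomomorphism t u t≈ˢu monomialTerm ⟩
    ⟦ u ⟧ monomialTerm  ≈⟨ ⟦⟧-monomialTerm u ⟩
    u                   ∎

theorem5p14 : ∀ {c ℓ} (R : CommutativeRing c ℓ) →
    let open CommutativeRing R in
    let open RingTerms R in
    ¬ (0# ≈ 1#) → (t u : Term) → (t ≈ˢ u) ⇔ (t ≈ᶠ u)
theorem5p14 R _ t u = mk⇔ (≈ˢ⇒≈ᶠ R t u) (≈ᶠ⇒≈ˢ R)
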